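{- Let $T$ be a recurrent tree set of characteristic $1$ on a finite alphabet, closed under reversal. Then $T$ is full.
   Context: Words are over a finite alphabet $A$; $\varepsilon$ is the empty word. A set $S$ of words on $A$ is factorial if it contains $A$ and all the factors of its elements. For $w\in S$ let $L(w)=\{a\in A\mid aw\in S\}$, $R(w)=\{a\in A\mid wa\in S\}$, $B(w)=\{(a,b)\in A\times A\mid awb\in S\}$. A factorial set $S$ is biextendable if $B(w)\neq\emptyset$ for all $w\in S$. The extension graph $\mathcal{E}(w)$ is the undirected graph whose vertex set is the disjoint union of $L(w)$ and $R(w)$ and whose edges are the pairs in $B(w)$. A biextendable set $S$ is a tree set of characteristic $1$ if $\mathcal{E}(w)$ is a tree for every $w\in S$ (including $w=\varepsilon$). A set $S\ne\{\varepsilon\}$ is recurrent if it is factorial and for all $u,w\in S$ there is $v\in S$ with $uvw\in S$. The reversal of $w=a_1a_2\cdots a_n$ is $\tilde w=a_n\cdots a_2a_1$; $w$ is a palindrome if $w=\tilde w$; a set is closed under reversal if it contains the reversal of each of its elements. A word of length $n$ has at most $n+1$ distinct palindrome factors (including $\varepsilon$); it is full if it has exactly $n+1$ palindrome factors. A factorial set is full if all its elements are full. -}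

module Defs where

open import Data.List.Base using (List; []; _∷_; [_]; _++_; _∷ʳ_; length; reverse)
import Data.List.Membership.Propositional as List
open import Data.List.Relation.Binary.Infix.Heterogeneous using (Infix; there; _ⁱ++_)
open import Data.List.Relation.Binary.Infix.Heterogeneous.Properties using (fromPointwise)
import Data.List.Relation.Binary.Pointwise as Pointwise
open import Data.List.Relation.Unary.Linked using (Linked)
open import Data.List.Relation.Unary.Unique.Propositional using (Unique)
open import Data.Nat.Base using (ℕ; suc; _≤_)
open import Data.Product.Base using (∃-syntax; _×_; _,_)
open import Data.Sum.Base as Sum using (_⊎_; inj₁; inj₂)
open import Function.Bundles using (_⇔_)
open import Level using (Level; _⊔_) renaming (suc to lsuc)
open import Relation.Binary.Core using (Rel)
open import Relation.Binary.Construct.Closure.ReflexiveTransitive using (Star)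
open import Relation.Binary.Definitions using (Symmetric; Irreflexive)
open import Relation.Binary.PropositionalEquality using (_≡_; refl)
open import Relation.Nullary.Negation using (¬_)
open import Relation.Unary using (Pred; _∈_; _≐_; ｛_｝; Satisfiable)

private
  variable
    a c p e ℓ : Level
    A : Set a

-- Simple undirected graphs.  The vertex set is a subset of an ambient
-- type, so that a vertex does not carry a proof of membership.

record Graph (c p e : Level) : Set (lsuc (c ⊔ p ⊔ e)) where
  field
    Carrier  : Set c
    Vertices : Pred Carrier p
    Adj      : Rel Carrier e
    adj-sym    : Symmetric Adj
    adj-irrefl : Irreflexive _≡_ Adj
    adj-vertex : ∀ {x y} → Adj x y → x ∈ Vertices

module _ (G : Graph c p e) where
  open Graph G

  Connected : Set (c ⊔ p ⊔ e)
  Connected = ∀ {x y} → x ∈ Vertices → y ∈ Vertices → Star Adj x y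

  -- The cycle x, xs₁, …, xsₖ, x, with k ≥ 2 so that traversing one edge
  -- back and forth does not count.
  IsCycle : Carrier → List Carrier → Set (c ⊔ e)
  IsCycle x xs = 2 ≤ length xs × Unique (x ∷ xs) × Linked Adj (x ∷ xs ∷ʳ x)

  Acyclic : Set (c ⊔ e)
  Acyclic = ∀ x xs → ¬ IsCycle x xs

  record IsTree : Set (c ⊔ p ⊔ e) where
    field
      nonempty  : Satisfiable Vertices
      connected : Connected
      acyclic   : Acyclic

-- Words over A are lists; sets of words are predicates.

IsFactor : {A : Set a} → Rel (List A) a
IsFactor = Infix _≡_

factor-refl : {w : List A} → IsFactor w w
factor-refl = fromPointwise (Pointwise.refl refl)

module _ {A : Set a} (S : Pred (List A) ℓ) where

  record Factorial : Set (a ⊔ ℓ) where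
    field
      letters : ∀ x → [ x ] ∈ S
      factors : ∀ {u w} → IsFactor u w → w ∈ S → u ∈ S

  L : List A → Pred A ℓ
  L w x = x ∷ w ∈ S

  R : List A → Pred A ℓ
  R w y = w ∷ʳ y ∈ S

  B : List A → Pred (A × A) ℓ
  B w (x , y) = x ∷ w ∷ʳ y ∈ S

  record Biextendable : Set (a ⊔ ℓ) where
    field
      factorial : Factorial
      extends   : ∀ w → w ∈ S → Satisfiable (B w)

  data ExtensionEdge (w : List A) : Rel (A ⊎ A) (a ⊔ ℓ) where
    left-right : ∀ {x y} → (x , y) ∈ B w → ExtensionEdge w (inj₁ x) (inj₂ y)
    right-left : ∀ {x y} → (x , y) ∈ B w → ExtensionEdge w (inj₂ y) (inj₁ x)

  -- Factoriality is used only to see that the endpoints of edges are vertices.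
  extensionGraph : Factorial → List A → Graph a ℓ (a ⊔ ℓ)
  extensionGraph fac w = record
    { Carrier    = A ⊎ A
    ; Vertices   = Sum.[ L w , R w ]
    ; Adj        = ExtensionEdge w
    ; adj-sym    = λ { (left-right b) → right-left b ; (right-left b) → left-right b }
    ; adj-irrefl = λ { refl () }
    ; adj-vertex = λ
        { (left-right {x} {y} b) → factors (factor-refl ⁱ++ [ y ]) b
        ; (right-left b)         → factors (there factor-refl) b
        }
    }
    where open Factorial fac

  -- Tree sets of characteristic 1.
  record IsTreeSet : Set (a ⊔ ℓ) where
    field
      biextendable : Biextendable
    open Biextendable biextendable public
    field
      tree : ∀ w → w ∈ S → IsTree (extensionGraph factorial w)

  record Recurrent : Set (a ⊔ ℓ) where
    field
      nontrivial : ¬ (S ≐ ｛ [] ｝)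
      factorial  : Factorial
      recurs     : ∀ u w → u ∈ S → w ∈ S → ∃[ v ] (v ∈ S × u ++ v ++ w ∈ S)

  ClosedUnderReversal : Set (a ⊔ ℓ)
  ClosedUnderReversal = ∀ w → w ∈ S → reverse w ∈ S

IsPalindrome : {A : Set a} → Pred (List A) a
IsPalindrome w = w ≡ reverse w

HasCardinality : {X : Set c} → Pred X p → ℕ → Set (c ⊔ p)
HasCardinality {X = X} P n =
  ∃[ xs ] (Unique xs × (∀ (x : X) → (x List.∈ xs) ⇔ P x) × length xs ≡ n)

IsFullWord : {A : Set a} → Pred (List A) a
IsFullWord w = HasCardinality (λ u → IsPalindrome u × IsFactor u w) (suc (length w))

IsFullSet : {A : Set a} → Pred (List A) ℓ → Set (a ⊔ ℓ)
IsFullSet S = ∀ w → w ∈ S → IsFullWord w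

{-# OPTIONS --safe #-}
module Submission where

-- Attach to each n the graph whose vertices are the words of length n in T up
-- to reversal and whose edges are the words of length n + 1 up to reversal; its
-- loops are the palindromes.  Without the loops it is a tree: it arises from the
-- graph for n − 1 by replacing each vertex w by the tree E(w), divided by the
-- swap of its two sides when w is a palindrome.  The proof uses this in
-- cohomological form, mod 2: every function on edges which vanishes on the loops
-- is a coboundary (mirror-coboundary).
--
-- Let z be the longest palindromic prefix of a word x w in T.  If z recurs, the
-- prefix v ending with its second occurrence is not a palindrome; write
-- v = q b ⋯ and reverse v = q b′ ⋯ with b ≠ b′.  Then v traces a closed walk at
-- the vertex q which traverses the edge q b exactly once, which is impossible in
-- a tree.  So each letter contributes a new palindrome, and x w is full.

open import Defs
open import Data.Bool.Base using (Bool; true; false; not; _xor_; if_then_else_)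
open import Data.Bool.Properties using (xor-assoc; xor-same; xor-comm; xor-identityʳ; xor-inverseˡ)
open import Data.Bool.Solver using (module xor-∧-Solver)
open import Data.Empty using (⊥)
open import Data.Fin.Base using (Fin; toℕ)
import Data.Fin.Properties as Fin
open import Data.List.Base
  using (List; []; _∷_; [_]; _++_; _∷ʳ_; length; map; reverse; initLast; _∷ʳ′_)
open import Data.List.Membership.Propositional using () renaming (_∈_ to _∈ˡ_)
open import Data.List.Properties
  using ( ≡-dec; ∷-injective; ∷-injectiveˡ; ∷-injectiveʳ; map-injective
        ; ++-assoc; ++-identityʳ; ++-cancelˡ; ++-conicalʳ; ∷ʳ-++
        ; length-++; length-++-≤ʳ; length-reverse
        ; unfold-reverse; reverse-++; reverse-involutive)
open import Data.List.Relation.Binary.Infix.Heterogeneous using (here; there; _++ⁱ_; _ⁱ++_)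
open import Data.List.Relation.Binary.Lex.NonStrict using () renaming (≤-decTotalOrder to lexicographic)
open import Data.List.Relation.Binary.Pointwise as Pointwise using (Pointwise-≡⇒≡)
open import Data.List.Relation.Binary.Prefix.Heterogeneous as Prefix using (Prefix)
open import Data.List.Relation.Binary.Prefix.Heterogeneous.Properties using (prefix?)
open import Data.List.Relation.Unary.All as All using (All; []; _∷_)
open import Data.List.Relation.Unary.All.Properties using (++⁻ˡ)
open import Data.List.Relation.Unary.AllPairs using ([]; _∷_)
open import Data.List.Relation.Unary.Any using (here; there)
open import Data.List.Relation.Unary.Linked using (Linked; [-]; _∷_)
open import Data.List.Relation.Unary.Unique.Propositional using (Unique)
open import Data.Nat.Base using (ℕ; zero; suc; _+_; _≤_; _<_; s≤s; z≤n)
import Data.Nat.Properties as ℕ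
open import Data.Product.Base using (∃-syntax; _×_; _,_; proj₁; proj₂)
open import Data.Sum.Base using (_⊎_; inj₁; inj₂; swap) renaming ([_,_] to ⊎[_,_])
import Data.Sum.Properties as Sum
open import Effect.Monad using (RawMonad)
open import Function.Base using (_∘_; const)
open import Function.Bundles using (_↔_; Inverse; mk⇔; Equivalence)
open import Function.Properties.Inverse using (↔⇒↣)
open import Level using (Level; _⊔_)
open import Relation.Binary.Bundles using (DecTotalOrder)
open import Relation.Binary.Construct.Closure.ReflexiveTransitive using (Star; ε; _◅_; _◅◅_; gmap)
open import Relation.Binary.Definitions using (DecidableEquality)
open import Relation.Binary.PropositionalEquality
  using (_≡_; _≢_; refl; sym; trans; cong; cong₂; subst; module ≡-Reasoning)
open import Relation.Nullary.Decidable
  using (yes; no; does; via-injection; dec-true; dec-false; ¬¬-excluded-middle)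
open import Relation.Nullary.Negation using (¬_; contradiction; ¬¬-Monad; ¬¬-map)
open import Relation.Unary using (Pred; _∈_; Decidable; Satisfiable)

private
  variable
    a ℓ ℓ₁ ℓ₂ ℓ₃ : Level
    A : Set a

open ≡-Reasoning
open xor-∧-Solver using (solve; _:=_; _:+_)

xor-cancelˡ : ∀ x y → x xor (x xor y) ≡ y
xor-cancelˡ = solve 2 (λ x y → x :+ (x :+ y) := y) refl

xor-cancelʳ : ∀ z {x y} → x xor z ≡ y xor z → x ≡ y
xor-cancelʳ z {x} {y} eq = begin
  x                ≡⟨ x≡xzz x z ⟩
  (x xor z) xor z  ≡⟨ cong (_xor z) eq ⟩
  (y xor z) xor z  ≡⟨ x≡xzz y z ⟨
  y                ∎
  where
  x≡xzz : ∀ x z → x ≡ (x xor z) xor z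
  x≡xzz = solve 2 (λ x z → x := (x :+ z) :+ z) refl

xor≡false⇒≡ : ∀ x y → x xor y ≡ false → x ≡ y
xor≡false⇒≡ false false _ = refl
xor≡false⇒≡ true  true  _ = refl

module _ {V : Set ℓ₁} {E : V → V → Set ℓ₃} (weight : V → V → Bool) where

  totalWeight : ∀ {x y} → Star E x y → Bool
  totalWeight ε = false
  totalWeight (_◅_ {x} {y} _ es) = weight x y xor totalWeight es

  totalWeight-◅◅ : ∀ {x y z} (es : Star E x y) (fs : Star E y z) →
                   totalWeight (es ◅◅ fs) ≡ totalWeight es xor totalWeight fs
  totalWeight-◅◅ ε fs = refl
  totalWeight-◅◅ (_◅_ {x} {y} _ es) fs =
    trans (cong (weight x y xor_) (totalWeight-◅◅ es fs))
          (sym (xor-assoc (weight x y) _ _))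

-- Since there are no cycles, loop erasure only deletes edges traversed back and
-- forth, so it turns a walk into a simple path of the same weight mod 2.
module AcyclicGraph (G : Graph ℓ₁ ℓ₂ ℓ₃) (_≟_ : DecidableEquality (Graph.Carrier G))
                    (acyclic : Acyclic G)
                    (weight : Graph.Carrier G → Graph.Carrier G → Bool)
                    (weight-sym : ∀ x y → weight x y ≡ weight y x) where
  open Graph G

  -- The list consists of the vertices of the path except the last one, z.
  data SimplePath (z : Carrier) : Carrier → List Carrier → Set (ℓ₁ ⊔ ℓ₃) where
    stop : SimplePath z z []
    step : ∀ {x y ys} → Adj x y → z ≢ x → All (x ≢_) ys →
           SimplePath z y ys → SimplePath z x (x ∷ ys)

  pathWeight : ∀ {x z xs} → SimplePath z x xs → Bool
  pathWeight stop = false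
  pathWeight (step {x} {y} _ _ _ π) = weight x y xor pathWeight π

  path-linked : ∀ {x y z ys} → Adj x y → SimplePath z y ys → Linked Adj (x ∷ ys ∷ʳ z)
  path-linked xy stop             = xy ∷ [-]
  path-linked xy (step yy′ _ _ π) = xy ∷ path-linked yy′ π

  path-avoids-end : ∀ {y z ys} → SimplePath z y ys → All (z ≢_) ys
  path-avoids-end stop             = []
  path-avoids-end (step _ z≢x _ π) = z≢x ∷ path-avoids-end π

  path-unique : ∀ {y z ys} → SimplePath z y ys → Unique ys
  path-unique stop              = []
  path-unique (step _ _ x∉ys π) = x∉ys ∷ path-unique π

  split : ∀ u {y z ys} (π : SimplePath z y ys) →
          (z ≢ u × All (u ≢_) ys) ⊎
          (∃[ as ] ∃[ bs ] ys ≡ as ++ bs ×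
             (∃[ σ ] ∃[ τ ] pathWeight {y} {u} {as} σ xor pathWeight {u} {z} {bs} τ ≡ pathWeight π))
  split u {z = z} stop with z ≟ u
  ... | yes refl = inj₂ ([] , [] , refl , stop , stop , refl)
  ... | no z≢u   = inj₁ (z≢u , [])
  split u (step {x} {y} xy z≢x x∉ys π) with u ≟ x
  ... | yes refl = inj₂ ([] , _ , refl , stop , step xy z≢x x∉ys π , refl)
  ... | no u≢x with split u π
  ...   | inj₁ (z≢u , u∉ys) = inj₁ (z≢u , u≢x ∷ u∉ys)
  ...   | inj₂ (as , bs , refl , σ , τ , eq) =
          inj₂ (x ∷ as , bs , refl , step xy u≢x (++⁻ˡ as x∉ys) σ , τ ,
                trans (xor-assoc (weight x y) _ _) (cong (weight x y xor_) eq))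

  simplify : ∀ {x z} (es : Star Adj x z) →
             ∃[ xs ] ∃[ π ] pathWeight {x} {z} {xs} π ≡ totalWeight weight es
  simplify ε = [] , stop , refl
  simplify (_◅_ {x} {y} xy es) with simplify es
  ... | ys , π , eq with split x π
  ...   | inj₁ (z≢x , x∉ys) = x ∷ ys , step xy z≢x x∉ys π , cong (weight x y xor_) eq
  ...   | inj₂ (_ , _ , refl , stop , _) = contradiction xy (adj-irrefl refl)
  ...   | inj₂ (_ , bs , refl , step _ _ _ stop , τ , eq′) = bs , τ , (begin
          pathWeight τ                                              ≡⟨ xor-cancelˡ (weight x y) _ ⟨
          weight x y xor (weight x y xor pathWeight τ)
            ≡⟨ cong (λ b → weight x y xor (b xor pathWeight τ)) (trans (weight-sym x y) (sym (xor-identityʳ _))) ⟩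
          weight x y xor ((weight y x xor false) xor pathWeight τ)  ≡⟨ cong (weight x y xor_) (trans eq′ eq) ⟩
          weight x y xor totalWeight weight es                      ∎)
  ...   | inj₂ (ys , _ , refl , σ@(step _ _ _ (step _ _ _ _)) , _) =
          contradiction (s≤s (s≤s z≤n) , path-avoids-end σ ∷ path-unique σ , path-linked xy σ)
                        (acyclic x ys)

  closed-walk-weight : ∀ {x} (es : Star Adj x x) → totalWeight weight es ≡ false
  closed-walk-weight es with simplify es
  ... | _ , stop , eq           = sym eq
  ... | _ , step _ x≢x _ _ , _ = contradiction refl x≢x

  module Potential (connected : Connected G) root (root∈V : root ∈ Vertices) where

    potential : ∀ {x} → x ∈ Vertices → Bool
    potential x∈V = totalWeight weight (connected root∈V x∈V)

    walk-weight : ∀ {x y} (x∈V : x ∈ Vertices) (y∈V : y ∈ Vertices) (es : Star Adj x y) →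
                  totalWeight weight es ≡ potential x∈V xor potential y∈V
    walk-weight {x} {y} x∈V y∈V es = begin
      totalWeight weight es
        ≡⟨ solve 2 (λ w q → w := (w :+ q) :+ q) refl (totalWeight weight es) (potential y∈V) ⟩
      (totalWeight weight es xor potential y∈V) xor potential y∈V
        ≡⟨ cong (_xor potential y∈V) (sym px≡w+py) ⟩
      potential x∈V xor potential y∈V ∎
      where
      back : Star Adj y root
      back = connected y∈V root∈V

      py≡back : potential y∈V ≡ totalWeight weight back
      py≡back = xor≡false⇒≡ _ _ (trans (sym (totalWeight-◅◅ weight (connected root∈V y∈V) back))
                                       (closed-walk-weight (connected root∈V y∈V ◅◅ back)))

      px≡w+py : potential x∈V ≡ totalWeight weight es xor potential y∈V
      px≡w+py = xor≡false⇒≡ _ _ (begin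
        potential x∈V xor (totalWeight weight es xor potential y∈V)
          ≡⟨ cong (λ b → potential x∈V xor (totalWeight weight es xor b)) py≡back ⟩
        potential x∈V xor (totalWeight weight es xor totalWeight weight back)
          ≡⟨ cong (potential x∈V xor_) (totalWeight-◅◅ weight es back) ⟨
        potential x∈V xor totalWeight weight (es ◅◅ back)
          ≡⟨ totalWeight-◅◅ weight (connected root∈V x∈V) (es ◅◅ back) ⟨
        totalWeight weight (connected root∈V x∈V ◅◅ es ◅◅ back)
          ≡⟨ closed-walk-weight (connected root∈V x∈V ◅◅ es ◅◅ back) ⟩
        false ∎)

length-∷ʳ : ∀ w (x : A) → length (w ∷ʳ x) ≡ suc (length w)
length-∷ʳ w x = trans (length-++ w) (ℕ.+-comm (length w) 1)

reverse-∷-∷ʳ : ∀ (x : A) w y → reverse (x ∷ w ∷ʳ y) ≡ y ∷ reverse w ∷ʳ x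
reverse-∷-∷ʳ x w y = trans (unfold-reverse x (w ∷ʳ y)) (cong (_∷ʳ x) (reverse-++ w [ y ]))

prefix⇒++ : ∀ {u w : List A} → Prefix _≡_ u w → ∃[ β ] w ≡ u ++ β
prefix⇒++ pre with u≋ Prefix.++ β ← Prefix.toView pre = β , cong (_++ β) (sym (Pointwise-≡⇒≡ u≋))

++-prefix : ∀ (u : List A) β → Prefix _≡_ u (u ++ β)
++-prefix u β = Prefix.fromView (Pointwise.refl refl Prefix.++ β)

++-factor : ∀ α {u : List A} β → IsFactor u (α ++ u ++ β)
++-factor α β = α ++ⁱ factor-refl ⁱ++ β

shorter-prefix : ∀ (u {s} v {t} : List A) → u ++ s ≡ v ++ t → length u ≤ length v →
                 ∃[ r ] v ≡ u ++ r
shorter-prefix []      v       _  _         = v , refl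
shorter-prefix (x ∷ u) (y ∷ v) eq (s≤s u≤v) with ∷-injective eq
... | refl , eq′ with r , v≡ ← shorter-prefix u v eq′ u≤v = r , cong (x ∷_) v≡

longest-prefix : ∀ {P : Pred (List A) ℓ₁} → Decidable P → ∀ w →
  (∃[ u ] ∃[ s ] w ≡ u ++ s × P u × (∀ v t → w ≡ v ++ t → P v → length v ≤ length u)) ⊎
  (∀ v t → w ≡ v ++ t → ¬ P v)
longest-prefix P? [] with P? []
... | yes P[] = inj₁ ([] , [] , refl , P[] , λ { [] _ _ _ → z≤n })
... | no ¬P[] = inj₂ λ { [] _ _ → ¬P[] }
longest-prefix P? (x ∷ w) with longest-prefix (P? ∘ (x ∷_)) w
... | inj₁ (u , s , w≡ , Pxu , longest) =
      inj₁ (x ∷ u , s , cong (x ∷_) w≡ , Pxu ,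
            λ { [] _ _ _ → z≤n ; (_ ∷ v) t refl Pv → s≤s (longest v t refl Pv) })
... | inj₂ none with P? []
...   | yes P[] = inj₁ ([] , x ∷ w , refl , P[] ,
                        λ { [] _ _ _ → z≤n ; (_ ∷ v) t refl Pv → contradiction Pv (none v t refl) })
...   | no ¬P[] = inj₂ λ { [] _ _ → ¬P[] ; (_ ∷ v) t refl → none v t refl }

module _ (_≟_ : DecidableEquality A) where

  first-difference : ∀ (u v : List A) → length u ≡ length v → u ≢ v →
    ∃[ q ] ∃[ x ] ∃[ y ] ∃[ s ] ∃[ t ] (x ≢ y × u ≡ q ++ x ∷ s × v ≡ q ++ y ∷ t)
  first-difference []      []      _  u≢v = contradiction refl u≢v
  first-difference (x ∷ u) (y ∷ v) eq u≢v with x ≟ y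
  ... | no x≢y = [] , x , y , u , v , x≢y , refl , refl
  ... | yes refl
      with q , x′ , y′ , s , t , x′≢y′ , u≡ , v≡ ← first-difference u v (ℕ.suc-injective eq) (u≢v ∘ cong (x ∷_))
      = x ∷ q , x′ , y′ , s , t , x′≢y′ , cong (x ∷_) u≡ , cong (x ∷_) v≡

  first-occurrence : ∀ u w → IsFactor u w →
    ∃[ α ] ∃[ β ] w ≡ α ++ u ++ β × (∀ γ δ → α ++ u ≡ γ ++ u ++ δ → δ ≡ [])
  first-occurrence u w i with prefix? _≟_ u w
  first-occurrence u w i | yes pre with β , refl ← prefix⇒++ pre = [] , β , refl , at-start
    where
    at-start : ∀ γ δ → u ≡ γ ++ u ++ δ → δ ≡ []
    at-start γ []      _  = refl
    at-start γ (x ∷ δ) eq = contradiction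
      (ℕ.≤-trans (length-++-≤ʳ (u ++ x ∷ δ) {γ}) (ℕ.≤-reflexive (sym (cong length eq))))
      (ℕ.<⇒≱ (ℕ.m<m+n (length u) {length (x ∷ δ)} (s≤s z≤n)) ∘ subst (_≤ length u) (length-++ u))
  first-occurrence u w (here pre) | no ¬pre = contradiction pre ¬pre
  first-occurrence u (x ∷ w) (there i) | no ¬pre with α , β , refl , first ← first-occurrence u w i =
    x ∷ α , β , refl , λ where
      []      δ eq → contradiction
        (subst (Prefix _≡_ u) (trans (sym (++-assoc u δ β)) (trans (cong (_++ β) (sym eq)) (++-assoc (x ∷ α) u β)))
               (++-prefix u (δ ++ β)))
        ¬pre
      (_ ∷ γ) δ eq → first γ δ (∷-injectiveʳ eq)

mirror : (List A → Bool) → List A → Bool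
mirror f w = f w xor f (reverse w)

mirror-reverse : ∀ (f : List A → Bool) w → mirror f (reverse w) ≡ mirror f w
mirror-reverse f w =
  trans (cong (λ z → f (reverse w) xor f z) (reverse-involutive w)) (xor-comm (f (reverse w)) (f w))

mirror-palindrome : ∀ (f : List A → Bool) {w} → IsPalindrome w → mirror f w ≡ false
mirror-palindrome f {w} pal = trans (cong (λ z → f w xor f z) (sym pal)) (xor-same (f w))

edgeWeight : (A → A → Bool) → A ⊎ A → A ⊎ A → Bool
edgeWeight f (inj₁ x) (inj₂ y) = f x y
edgeWeight f (inj₂ y) (inj₁ x) = f x y
edgeWeight f _        _        = false

edgeWeight-sym : ∀ (f : A → A → Bool) u v → edgeWeight f u v ≡ edgeWeight f v u
edgeWeight-sym f (inj₁ _) (inj₁ _) = refl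
edgeWeight-sym f (inj₁ _) (inj₂ _) = refl
edgeWeight-sym f (inj₂ _) (inj₁ _) = refl
edgeWeight-sym f (inj₂ _) (inj₂ _) = refl

edgeWeight-swap : ∀ {f : A → A → Bool} → (∀ x y → f x y ≡ f y x) →
                  ∀ u v → edgeWeight f (swap u) (swap v) ≡ edgeWeight f u v
edgeWeight-swap f-sym (inj₁ _) (inj₁ _) = refl
edgeWeight-swap f-sym (inj₁ x) (inj₂ y) = f-sym y x
edgeWeight-swap f-sym (inj₂ y) (inj₁ x) = f-sym y x
edgeWeight-swap f-sym (inj₂ _) (inj₂ _) = refl

module FiniteAlphabet {a} {A : Set a} {n : ℕ} (finite : A ↔ Fin n) where
  open Inverse finite

  infix 4 _≟_ _≟ʷ_

  _≟_ : DecidableEquality A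
  _≟_ = via-injection (↔⇒↣ finite) Fin._≟_

  _≟ʷ_ : DecidableEquality (List A)
  _≟ʷ_ = ≡-dec _≟_

  private
    rank : A → ℕ
    rank x = toℕ (to x)

    rank-injective : ∀ {x y} → rank x ≡ rank y → x ≡ y
    rank-injective {x} {y} eq =
      trans (sym (strictlyInverseʳ x)) (trans (cong from (Fin.toℕ-injective eq)) (strictlyInverseʳ y))

    open DecTotalOrder (lexicographic ℕ.≤-decTotalOrder) using (_≤?_; antisym; total)

  abstract
    precedes : List A → List A → Bool
    precedes u v = does (map rank u ≤? map rank v)

    precedes-flip : ∀ {u v} → u ≢ v → precedes u v ≡ not (precedes v u)
    precedes-flip {u} {v} u≢v with map rank u ≤? map rank v | map rank v ≤? map rank u
    ... | yes u≤v | yes v≤u =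
          contradiction (map-injective rank-injective (Pointwise-≡⇒≡ (antisym u≤v v≤u))) u≢v
    ... | yes _   | no  _   = refl
    ... | no  _   | yes _   = refl
    ... | no  u≰v | no  v≰u with total (map rank u) (map rank v)
    ...   | inj₁ u≤v = contradiction u≤v u≰v
    ...   | inj₂ v≤u = contradiction v≤u v≰u

  -- T need not be decidable.  Membership in T is decided under double negation,
  -- for the finitely many words of bounded length; this suffices because it is
  -- only used to refute that a palindrome recurs.
  ¬¬-shift : {P : Pred A ℓ₁} → (∀ x → ¬ ¬ P x) → ¬ ¬ (∀ x → P x)
  ¬¬-shift {P = P} ¬¬P =
    ¬¬-map (λ Pᶠ x → subst P (strictlyInverseʳ x) (Pᶠ (to x)))
           (Fin.sequence (RawMonad.rawApplicative ¬¬-Monad) (λ i → ¬¬P (from i)))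

  ¬¬-shift-words : ∀ m {P : Pred (List A) ℓ₁} → (∀ w → ¬ ¬ P w) →
                   (∀ w → m < length w → P w) → ¬ ¬ (∀ w → P w)
  ¬¬-shift-words zero ¬¬P long =
    ¬¬-map (λ { P[] [] → P[] ; P[] (x ∷ w) → long (x ∷ w) (s≤s z≤n) }) (¬¬P [])
  ¬¬-shift-words (suc m) {P} ¬¬P long = do
    P[] ← ¬¬P []
    P∷ ← ¬¬-shift (λ x → ¬¬-shift-words m {P ∘ (x ∷_)} (λ w → ¬¬P (x ∷ w))
                                         (λ w m<w → long (x ∷ w) (s≤s m<w)))
    λ k → k λ { [] → P[] ; (x ∷ w) → P∷ x w }
    where
    _>>=_ : ∀ {b c} {B : Set b} {C : Set c} → ¬ ¬ B → (B → ¬ ¬ C) → ¬ ¬ C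
    (m >>= f) k = m (λ x → f x k)

  module ReversalClosedTreeSet (T : Pred (List A) ℓ) (treeSet : IsTreeSet T)
                               (closed : ClosedUnderReversal T) where
    open IsTreeSet treeSet
    open Factorial factorial

    ∷-factor : ∀ x w → x ∷ w ∈ T → w ∈ T
    ∷-factor x w = factors (there factor-refl)

    ∷ʳ-factor : ∀ w y → w ∷ʳ y ∈ T → w ∈ T
    ∷ʳ-factor w y = factors (factor-refl ⁱ++ [ y ])

    closed-∷ : ∀ {x w} → x ∷ w ∈ T → reverse w ∷ʳ x ∈ T
    closed-∷ {x} {w} = subst T (unfold-reverse x w) ∘ closed (x ∷ w)

    closed-∷ʳ : ∀ {w y} → w ∷ʳ y ∈ T → y ∷ reverse w ∈ T
    closed-∷ʳ {w} {y} = subst T (reverse-++ w [ y ]) ∘ closed (w ∷ʳ y)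

    closed-∷-∷ʳ : ∀ {x w y} → x ∷ w ∷ʳ y ∈ T → y ∷ reverse w ∷ʳ x ∈ T
    closed-∷-∷ʳ {x} {w} {y} = subst T (reverse-∷-∷ʳ x w y) ∘ closed (x ∷ w ∷ʳ y)

    ExtensionVertices : List A → Pred (A ⊎ A) ℓ
    ExtensionVertices w = ⊎[ L T w , R T w ]

    Walk : List A → A ⊎ A → A ⊎ A → Set (a ⊔ ℓ)
    Walk w = Star (ExtensionEdge T w)

    module _ {w} (w∈T : w ∈ T) where
      open IsTree (tree w w∈T)

      extension-closed-walk : ∀ f {u} (es : Walk w u u) → totalWeight (edgeWeight f) es ≡ false
      extension-closed-walk f =
        AcyclicGraph.closed-walk-weight (extensionGraph T factorial w) (Sum.≡-dec _≟_ _≟_)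
          acyclic (edgeWeight f) (edgeWeight-sym f)

    IsPotential : (A → A → Bool) → List A → (A ⊎ A → Bool) → Set (a ⊔ ℓ)
    IsPotential f w h = w ∈ T → ∀ {u v} → u ∈ ExtensionVertices w → v ∈ ExtensionVertices w →
                        (es : Walk w u v) → totalWeight (edgeWeight f) es ≡ h u xor h v

    potential-exists : ∀ f w → ¬ ¬ (∃[ h ] IsPotential f w h)
    potential-exists f w k =
      ¬¬-excluded-middle {A = w ∈ T} λ where
        (no w∉T)  → k (const false , λ w∈T → contradiction w∈T w∉T)
        (yes w∈T) → ¬¬-shift (λ x → ¬¬-excluded-middle {A = x ∷ w ∈ T}) λ left? →
                    ¬¬-shift (λ y → ¬¬-excluded-middle {A = w ∷ʳ y ∈ T}) λ right? →
                    k (decided w∈T ⊎[ left? , right? ])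
      where
      decided : w ∈ T → Decidable (ExtensionVertices w) → ∃[ h ] IsPotential f w h
      decided w∈T vertex? = h , λ _ → spec
        where
        open IsTree (tree w w∈T)
        open AcyclicGraph (extensionGraph T factorial w) (Sum.≡-dec _≟_ _≟_)
          acyclic (edgeWeight f) (edgeWeight-sym f)
        open Potential connected (proj₁ nonempty) (proj₂ nonempty)

        h : A ⊎ A → Bool
        h u with vertex? u
        ... | yes u∈V = potential u∈V
        ... | no  _   = false

        spec : ∀ {u v} → u ∈ ExtensionVertices w → v ∈ ExtensionVertices w →
               (es : Walk w u v) → totalWeight (edgeWeight f) es ≡ h u xor h v
        spec {u} {v} u∈V v∈V es with vertex? u | vertex? v
        ... | yes u∈V′ | yes v∈V′ = walk-weight u∈V′ v∈V′ es
        ... | no  u∉V  | _        = contradiction u∈V u∉V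
        ... | yes _    | no v∉V   = contradiction v∈V v∉V

    potential-edge : ∀ {f w h x y} → IsPotential f w h → x ∷ w ∷ʳ y ∈ T →
                     f x y ≡ h (inj₁ x) xor h (inj₂ y)
    potential-edge {f} {w} {h} {x} {y} pot xwy∈T =
      trans (sym (xor-identityʳ (f x y)))
            (pot (∷ʳ-factor w y (∷-factor x (w ∷ʳ y) xwy∈T)) (∷ʳ-factor (x ∷ w) y xwy∈T)
                 (∷-factor x (w ∷ʳ y) xwy∈T) (left-right xwy∈T ◅ ε))

    module Palindrome {w} (pal : IsPalindrome w) (w∈T : w ∈ T) where
      open IsTree (tree w w∈T)

      ∷⇒∷ʳ : ∀ {x} → x ∷ w ∈ T → w ∷ʳ x ∈ T
      ∷⇒∷ʳ {x} xw∈T = subst (λ z → z ∷ʳ x ∈ T) (sym pal) (closed-∷ xw∈T)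

      ∷ʳ⇒∷ : ∀ {x} → w ∷ʳ x ∈ T → x ∷ w ∈ T
      ∷ʳ⇒∷ {x} wx∈T = subst (λ z → x ∷ z ∈ T) (sym pal) (closed-∷ʳ wx∈T)

      flip-∈T : ∀ {x y} → x ∷ w ∷ʳ y ∈ T → y ∷ w ∷ʳ x ∈ T
      flip-∈T {x} {y} xwy∈T = subst (λ z → y ∷ z ∷ʳ x ∈ T) (sym pal) (closed-∷-∷ʳ xwy∈T)

      swap-edge : ∀ {u v} → ExtensionEdge T w u v → ExtensionEdge T w (swap u) (swap v)
      swap-edge (left-right b) = right-left (flip-∈T b)
      swap-edge (right-left b) = left-right (flip-∈T b)

      swap-walk : ∀ {u v} → Walk w u v → Walk w (swap u) (swap v)
      swap-walk = gmap swap swap-edge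

      orientation : A → A → Bool
      orientation x y = precedes [ x ] [ y ]

      isRight : A ⊎ A → Bool
      isRight = ⊎[ const false , const true ]

      orientation-flip : ∀ {x y} → x ≢ y → orientation x y xor orientation y x ≡ true
      orientation-flip {x} {y} x≢y =
        trans (cong (_xor orientation y x) (precedes-flip (x≢y ∘ ∷-injectiveˡ)))
              (xor-inverseˡ (orientation y x))

      HasPalindromicExtension : Set (a ⊔ ℓ)
      HasPalindromicExtension = ∃[ x ] x ∷ w ∷ʳ x ∈ T

      edge-parity : ∀ {u v} → ExtensionEdge T w u v →
                    HasPalindromicExtension ⊎
                    edgeWeight orientation u v xor edgeWeight orientation (swap u) (swap v)
                      ≡ isRight u xor isRight v
      edge-parity (left-right {x} {y} b) with x ≟ y
      ... | yes refl = inj₁ (x , b)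
      ... | no x≢y   = inj₂ (orientation-flip x≢y)
      edge-parity (right-left {x} {y} b) with x ≟ y
      ... | yes refl = inj₁ (x , b)
      ... | no x≢y   = inj₂ (orientation-flip x≢y)

      walk-parity : ∀ {u v} (es : Walk w u v) →
                    HasPalindromicExtension ⊎
                    totalWeight (edgeWeight orientation) es xor
                    totalWeight (edgeWeight orientation) (swap-walk es) ≡ isRight u xor isRight v
      walk-parity {u} ε = inj₂ (sym (xor-same (isRight u)))
      walk-parity {u} {v} (_◅_ {j = u′} uu′ es) with edge-parity uu′ | walk-parity es
      ... | inj₁ ext | _        = inj₁ ext
      ... | inj₂ _   | inj₁ ext = inj₁ ext
      ... | inj₂ eq  | inj₂ eq′ = inj₂ (begin
        (o₁ xor t₁) xor (o₂ xor t₂)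
          ≡⟨ solve 4 (λ o₁ t₁ o₂ t₂ → (o₁ :+ t₁) :+ (o₂ :+ t₂) := (o₁ :+ o₂) :+ (t₁ :+ t₂)) refl o₁ t₁ o₂ t₂ ⟩
        (o₁ xor o₂) xor (t₁ xor t₂)
          ≡⟨ cong₂ _xor_ eq eq′ ⟩
        (isRight u xor isRight u′) xor (isRight u′ xor isRight v)
          ≡⟨ solve 3 (λ r r′ s → (r :+ r′) :+ (r′ :+ s) := r :+ s) refl (isRight u) (isRight u′) (isRight v) ⟩
        isRight u xor isRight v ∎)
        where
        ω = edgeWeight orientation
        o₁ = ω u u′
        o₂ = ω (swap u) (swap u′)
        t₁ = totalWeight ω es
        t₂ = totalWeight ω (swap-walk es)

      -- A walk from a left vertex to its right copy followed by its swapped image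
      -- is closed, hence of weight 0 in the tree; were x ≠ y on all its edges, the
      -- orientation would give it weight 1.
      palindromic-extension : HasPalindromicExtension
      palindromic-extension = from-vertex nonempty
        where
        from-left : ∀ {x} → x ∷ w ∈ T → HasPalindromicExtension
        from-left {x} xw∈T with es ← connected {inj₁ x} {inj₂ x} xw∈T (∷⇒∷ʳ xw∈T) | walk-parity es
        ... | inj₁ ext = ext
        ... | inj₂ odd = contradiction
          (begin
            true
              ≡⟨ odd ⟨
            totalWeight ω es xor totalWeight ω (swap-walk es)
              ≡⟨ totalWeight-◅◅ ω es (swap-walk es) ⟨
            totalWeight ω (es ◅◅ swap-walk es)
              ≡⟨ extension-closed-walk w∈T orientation (es ◅◅ swap-walk es) ⟩
            false ∎)
          λ ()
          where ω = edgeWeight orientation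

        from-vertex : Satisfiable (ExtensionVertices w) → HasPalindromicExtension
        from-vertex (inj₁ x , xw∈T) = from-left xw∈T
        from-vertex (inj₂ x , wx∈T) = from-left (∷ʳ⇒∷ wx∈T)

      swap-walk-weight : ∀ {f} → (∀ x y → f x y ≡ f y x) → ∀ {u v} (es : Walk w u v) →
                         totalWeight (edgeWeight f) (swap-walk es) ≡ totalWeight (edgeWeight f) es
      swap-walk-weight f-sym ε = refl
      swap-walk-weight f-sym (_◅_ {u} {v} _ es) =
        cong₂ _xor_ (edgeWeight-swap f-sym u v) (swap-walk-weight f-sym es)

      potential-swap : ∀ {f h} → IsPotential f w h →
                       (∀ x y → f x y ≡ f y x) → (∀ x → f x x ≡ false) →
                       ∀ {y} → y ∷ w ∈ T → h (inj₁ y) ≡ h (inj₂ y)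
      potential-swap {f} {h} pot f-sym f-diag {y} yw∈T with x , xwx∈T ← palindromic-extension =
        xor-cancelʳ (h (inj₁ x)) (begin
          h (inj₁ y) xor h (inj₁ x)                        ≡⟨ pot w∈T yw∈T xw∈T es ⟨
          totalWeight (edgeWeight f) es                    ≡⟨ swap-walk-weight f-sym es ⟨
          totalWeight (edgeWeight f) (swap-walk es)        ≡⟨ pot w∈T (∷⇒∷ʳ yw∈T) (∷⇒∷ʳ xw∈T) (swap-walk es) ⟩
          h (inj₂ y) xor h (inj₂ x)                        ≡⟨ cong (h (inj₂ y) xor_) (xor≡false⇒≡ _ _ hx≡) ⟨
          h (inj₂ y) xor h (inj₁ x)                        ∎)
        where
        xw∈T = ∷ʳ-factor (x ∷ w) x xwx∈T
        es = connected {inj₁ y} {inj₁ x} yw∈T xw∈T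
        hx≡ : h (inj₁ x) xor h (inj₂ x) ≡ false
        hx≡ = trans (sym (potential-edge {f} {h = h} pot xwx∈T)) (f-diag x)

    -- The trees of w and reverse w are isomorphic under the swap.  For
    -- w ≠ reverse w the order on words selects one of the two potentials, to be
    -- used for both; for w = reverse w the potential is invariant under the swap.
    mirror-splits : ∀ m f → ¬ ¬ (∃[ g ] (∀ x w y → length w ≡ m → x ∷ w ∷ʳ y ∈ T →
                                  mirror f (x ∷ w ∷ʳ y) ≡ g (x ∷ w) xor g (y ∷ reverse w)))
    mirror-splits m f = ¬¬-map construct
      (¬¬-shift-words m {λ w → ∃[ h ] (length w ≡ m → IsPotential (F w) w h)}
        (λ w → ¬¬-map (λ (h , pot) → h , λ _ → pot) (potential-exists (F w) w))
        (λ w m<w → const false , λ w≡m → contradiction (sym w≡m) (ℕ.<⇒≢ m<w)))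
      where
      F : List A → A → A → Bool
      F w x y = mirror f (x ∷ w ∷ʳ y)

      construct : (∀ w → ∃[ h ] (length w ≡ m → IsPotential (F w) w h)) →
                  ∃[ g ] (∀ x w y → length w ≡ m → x ∷ w ∷ʳ y ∈ T →
                          mirror f (x ∷ w ∷ʳ y) ≡ g (x ∷ w) xor g (y ∷ reverse w))
      construct choice = g , splits
        where
        h : List A → A ⊎ A → Bool
        h = proj₁ ∘ choice

        g : List A → Bool
        g []      = false
        g (x ∷ w) = if precedes w (reverse w) then h w (inj₁ x) else h (reverse w) (inj₂ x)

        g-precedes : ∀ {w} x → precedes w (reverse w) ≡ true → g (x ∷ w) ≡ h w (inj₁ x)
        g-precedes x eq rewrite eq = refl

        g-follows : ∀ {w} x → precedes w (reverse w) ≡ false → g (x ∷ w) ≡ h (reverse w) (inj₂ x)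
        g-follows x eq rewrite eq = refl

        reverse-precedes : ∀ {w} → w ≢ reverse w →
                           precedes (reverse w) (reverse (reverse w)) ≡ not (precedes w (reverse w))
        reverse-precedes {w} w≢rev =
          trans (cong (precedes (reverse w)) (reverse-involutive w)) (precedes-flip (w≢rev ∘ sym))

        splits : ∀ x w y → length w ≡ m → x ∷ w ∷ʳ y ∈ T →
                 mirror f (x ∷ w ∷ʳ y) ≡ g (x ∷ w) xor g (y ∷ reverse w)
        splits x w y w≡m xwy∈T with w ≟ʷ reverse w
        ... | yes pal = begin
          F w x y                        ≡⟨ potential-edge {F w} {h = h w} pot xwy∈T ⟩
          h w (inj₁ x) xor h w (inj₂ y)  ≡⟨ cong₂ _xor_ (g-palindrome xw∈T) (trans (cong (λ z → g (y ∷ z)) (sym pal)) (trans (g-palindrome yw∈T) (h-swap yw∈T))) ⟨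
          g (x ∷ w) xor g (y ∷ reverse w) ∎
          where
          pot = proj₂ (choice w) w≡m
          xw∈T = ∷ʳ-factor (x ∷ w) y xwy∈T
          w∈T = ∷-factor x w xw∈T
          open Palindrome pal w∈T
          yw∈T = ∷ʳ⇒∷ (∷-factor x (w ∷ʳ y) xwy∈T)

          h-swap : ∀ {z} → z ∷ w ∈ T → h w (inj₁ z) ≡ h w (inj₂ z)
          h-swap = potential-swap {F w} {h w} pot
            (λ x y → trans (sym (mirror-reverse f (x ∷ w ∷ʳ y)))
                           (cong (mirror f) (trans (reverse-∷-∷ʳ x w y) (cong (λ z → y ∷ z ∷ʳ x) (sym pal)))))
            (λ x → mirror-palindrome f (trans (cong (λ z → x ∷ z ∷ʳ x) pal) (sym (reverse-∷-∷ʳ x w x))))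

          g-palindrome : ∀ {z} → z ∷ w ∈ T → g (z ∷ w) ≡ h w (inj₁ z)
          g-palindrome {z} zw∈T with precedes w (reverse w)
          ... | true  = refl
          ... | false = trans (cong (λ v → h v (inj₂ z)) (sym pal)) (sym (h-swap zw∈T))
        ... | no w≢rev with precedes w (reverse w) in eq
        ...   | true = begin
          F w x y                           ≡⟨ potential-edge {F w} {h = h w} (proj₂ (choice w) w≡m) xwy∈T ⟩
          h w (inj₁ x) xor h w (inj₂ y)     ≡⟨ cong (h w (inj₁ x) xor_) (trans (g-follows y (trans (reverse-precedes w≢rev) (cong not eq))) (cong (λ v → h v (inj₂ y)) (reverse-involutive w))) ⟨
          h w (inj₁ x) xor g (y ∷ reverse w)   ∎
        ...   | false = begin
          F w x y                                             ≡⟨ trans (sym (mirror-reverse f (x ∷ w ∷ʳ y))) (cong (mirror f) (reverse-∷-∷ʳ x w y)) ⟩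
          F (reverse w) y x                                   ≡⟨ potential-edge {F (reverse w)} {h = h (reverse w)} (proj₂ (choice (reverse w)) (trans (length-reverse w) w≡m)) (closed-∷-∷ʳ xwy∈T) ⟩
          h (reverse w) (inj₁ y) xor h (reverse w) (inj₂ x)   ≡⟨ xor-comm (h (reverse w) (inj₁ y)) _ ⟩
          h (reverse w) (inj₂ x) xor h (reverse w) (inj₁ y)   ≡⟨ cong (h (reverse w) (inj₂ x) xor_) (g-precedes y (trans (reverse-precedes w≢rev) (cong not eq))) ⟨
          h (reverse w) (inj₂ x) xor g (y ∷ reverse w) ∎

    -- Functions of the form mirror f are, mod 2, the reversal-invariant ones
    -- which vanish on palindromes.
    IsCoboundary : ℕ → (List A → Bool) → (List A → Bool) → Set (a ⊔ ℓ)
    IsCoboundary m f g =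
      (∀ w → length w ≡ suc m → w ∈ T → g (reverse w) ≡ g w) ×
      (∀ x u y → length u ≡ m → x ∷ u ∷ʳ y ∈ T → mirror f (x ∷ u ∷ʳ y) ≡ g (x ∷ u) xor g (u ∷ʳ y))

    mirror-coboundary : ∀ m f → ¬ ¬ (∃[ g ] IsCoboundary m f g)
    mirror-coboundary zero f = ¬¬-map from-splitting (mirror-splits zero f)
      where
      from-splitting : _ → ∃[ g ] IsCoboundary zero f g
      from-splitting (g , splits) =
        g , (λ { (x ∷ []) _ _ → refl }) , λ { x [] y _ xy∈T → splits x [] y refl xy∈T }
    mirror-coboundary (suc m) f k =
      mirror-splits (suc m) f λ (h , splits) →
      mirror-coboundary m h λ (k′ , k′-reverse , k′-edge) →
      k (construct h splits k′ k′-reverse k′-edge)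
      where
      -- k w is the constant by which the potential of the tree of w is corrected
      -- to make the potentials of all trees agree.
      construct : ∀ h →
        (∀ x w y → length w ≡ suc m → x ∷ w ∷ʳ y ∈ T →
         mirror f (x ∷ w ∷ʳ y) ≡ h (x ∷ w) xor h (y ∷ reverse w)) →
        ∀ k → (∀ w → length w ≡ suc m → w ∈ T → k (reverse w) ≡ k w) →
        (∀ x u y → length u ≡ m → x ∷ u ∷ʳ y ∈ T →
         mirror h (x ∷ u ∷ʳ y) ≡ k (x ∷ u) xor k (u ∷ʳ y)) →
        ∃[ g ] IsCoboundary (suc m) f g
      construct h splits k k-reverse k-edge = g , g-reverse , g-edge
        where
        g : List A → Bool
        g []      = false
        g (x ∷ w) = h (x ∷ w) xor k w

        g-reverse : ∀ w → length w ≡ suc (suc m) → w ∈ T → g (reverse w) ≡ g w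
        g-reverse (x ∷ w) eq w∈T with initLast w
        ... | u ∷ʳ′ y = trans (cong g (reverse-∷-∷ʳ x u y)) (begin
          h (y ∷ reverse u ∷ʳ x) xor k (reverse u ∷ʳ x)
            ≡⟨ cong₂ _xor_ (cong h (sym (reverse-∷-∷ʳ x u y))) (trans (cong k (sym (unfold-reverse x u))) (k-reverse (x ∷ u) (cong suc |u|≡m) (∷ʳ-factor (x ∷ u) y w∈T))) ⟩
          h (reverse v) xor k (x ∷ u)
            ≡⟨ solve 3 (λ h h′ k → h′ :+ k := (h :+ (h :+ h′)) :+ k) refl (h v) (h (reverse v)) (k (x ∷ u)) ⟩
          (h v xor mirror h v) xor k (x ∷ u)
            ≡⟨ cong (λ b → (h v xor b) xor k (x ∷ u)) (k-edge x u y |u|≡m w∈T) ⟩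
          (h v xor (k (x ∷ u) xor k (u ∷ʳ y))) xor k (x ∷ u)
            ≡⟨ solve 3 (λ h k k′ → (h :+ (k :+ k′)) :+ k := h :+ k′) refl (h v) (k (x ∷ u)) (k (u ∷ʳ y)) ⟩
          h v xor k (u ∷ʳ y) ∎)
          where
          v = x ∷ u ∷ʳ y
          |u|≡m : length u ≡ m
          |u|≡m = ℕ.suc-injective (trans (sym (length-∷ʳ u y)) (ℕ.suc-injective eq))

        g-edge : ∀ x u y → length u ≡ suc m → x ∷ u ∷ʳ y ∈ T →
                 mirror f (x ∷ u ∷ʳ y) ≡ g (x ∷ u) xor g (u ∷ʳ y)
        g-edge x u y |u|≡ xuy∈T = begin
          mirror f (x ∷ u ∷ʳ y)
            ≡⟨ splits x u y |u|≡ xuy∈T ⟩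
          h (x ∷ u) xor h (y ∷ reverse u)
            ≡⟨ solve 3 (λ h h′ k → h :+ h′ := (h :+ k) :+ (h′ :+ k)) refl (h (x ∷ u)) (h (y ∷ reverse u)) (k u) ⟩
          g (x ∷ u) xor (h (y ∷ reverse u) xor k u)
            ≡⟨ cong (λ b → g (x ∷ u) xor (h (y ∷ reverse u) xor b)) (k-reverse u |u|≡ (∷-factor x u (∷ʳ-factor (x ∷ u) y xuy∈T))) ⟨
          g (x ∷ u) xor g (y ∷ reverse u)
            ≡⟨ cong (λ w → g (x ∷ u) xor g w) (reverse-++ u [ y ]) ⟨
          g (x ∷ u) xor g (reverse (u ∷ʳ y))
            ≡⟨ cong (g (x ∷ u) xor_) (g-reverse (u ∷ʳ y) (trans (length-∷ʳ u y) (cong suc |u|≡)) (∷-factor x (u ∷ʳ y) xuy∈T)) ⟩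
          g (x ∷ u) xor g (u ∷ʳ y) ∎

    potential-constant :
      ∀ {m f g} → IsCoboundary m f g →
      ∀ {u} r {u′} v → length u ≡ suc m → length u′ ≡ suc m → u ++ r ≡ v ++ u′ → u ++ r ∈ T →
      (∀ α z β → u ++ r ≡ α ++ z ++ β → length z ≡ suc (suc m) → mirror f z ≡ false) →
      g u ≡ g u′
    potential-constant {g = g} cob {u} [] [] _ _ eq _ _ = cong g (trans (sym (++-identityʳ u)) eq)
    potential-constant {f = f} cob {u} [] {u′} (c ∷ v) |u| |u′| eq _ _ =
      contradiction (ℕ.<-≤-trans (s≤s (length-++-≤ʳ u′ {v})) (ℕ.≤-reflexive (sym |cvu′|≡|u′|))) (ℕ.<-irrefl refl)
      where
      |cvu′|≡|u′| : length u′ ≡ length (c ∷ v ++ u′)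
      |cvu′|≡|u′| = trans |u′| (trans (sym |u|) (cong length (trans (sym (++-identityʳ u)) eq)))
    potential-constant {f = f} cob {u} (y ∷ r) {u′} [] |u| |u′| eq _ _ =
      contradiction (trans (sym (length-++ u)) (trans (cong length eq) (trans |u′| (sym |u|))))
                    (ℕ.m+1+n≢m (length u))
    potential-constant {f = f} {g = g} cob@(_ , edge) {x ∷ u} (y ∷ r) {u′} (c ∷ v) |xu| |u′| eq xuyr∈T vanishes =
      trans (xor≡false⇒≡ (g (x ∷ u)) (g (u ∷ʳ y)) g-step)
            (potential-constant {f = f} cob r v (trans (length-∷ʳ u y) |xu|) |u′|
              (trans (∷ʳ-++ u y r) (∷-injectiveʳ eq))
              (∷-factor x ((u ∷ʳ y) ++ r) xuyr∈T′)
              λ α z β eq′ → vanishes (x ∷ α) z β (cong (x ∷_) (trans (sym (∷ʳ-++ u y r)) eq′)))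
      where
      xuyr∈T′ : x ∷ u ∷ʳ y ++ r ∈ T
      xuyr∈T′ = subst (λ z → x ∷ z ∈ T) (sym (∷ʳ-++ u y r)) xuyr∈T

      g-step : g (x ∷ u) xor g (u ∷ʳ y) ≡ false
      g-step = trans (sym (edge x u y (ℕ.suc-injective |xu|) (factors (factor-refl ⁱ++ r) xuyr∈T′)))
                     (vanishes [] (x ∷ u ∷ʳ y) r (cong (x ∷_) (sym (∷ʳ-++ u y r)))
                               (cong suc (trans (length-∷ʳ u y) |xu|)))

    module LongestPalindromicPrefix {x w} (xw∈T : x ∷ w ∈ T) {z₀ s} (xw≡ : x ∷ w ≡ x ∷ z₀ ++ s)
      (z-palindrome : IsPalindrome (x ∷ z₀))
      (longest : ∀ v t → x ∷ w ≡ v ++ t → IsPalindrome v → length v ≤ length (x ∷ z₀)) where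

      private
        z : List A
        z = x ∷ z₀

      longer-prefix : ∀ {r t} → r ≢ [] → x ∷ w ≡ (z ++ r) ++ t → ¬ IsPalindrome (z ++ r)
      longer-prefix {[]}    r≢[] _  _   = r≢[] refl
      longer-prefix {y ∷ r} {t} _ eq pal =
        ℕ.<⇒≱ (subst (length z <_) (sym (length-++ z)) (ℕ.m<m+n (length z) (s≤s z≤n)))
               (longest (z ++ y ∷ r) t eq pal)

      module FirstReturn {α β} (w≡ : w ≡ α ++ z ++ β)
                         (first : ∀ γ δ → α ++ z ≡ γ ++ z ++ δ → δ ≡ []) where

        v : List A
        v = x ∷ α ++ z

        xw≡vβ : x ∷ w ≡ v ++ β
        xw≡vβ = cong (x ∷_) (trans w≡ (sym (++-assoc α z β)))

        v∈T : v ∈ T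
        v∈T = factors (++-factor [] β) (subst T xw≡vβ xw∈T)

        reverse-v : reverse v ≡ z ++ reverse (x ∷ α)
        reverse-v = trans (reverse-++ (x ∷ α) z) (cong (_++ reverse (x ∷ α)) (sym z-palindrome))

        module Divergence {q₁ b b′ t t′} (b≢b′ : b ≢ b′) (v≡ : v ≡ z ++ q₁ ++ b ∷ t)
                          (reverse-v≡ : reverse v ≡ z ++ q₁ ++ b′ ∷ t′) where

          u q c : List A
          u = z₀ ++ q₁
          q = x ∷ u
          c = q ∷ʳ b

          f : List A → Bool
          f y = does (y ≟ʷ c)

          v≡ct : v ≡ c ++ t
          v≡ct = trans v≡ (trans (sym (++-assoc z q₁ (b ∷ t))) (sym (∷ʳ-++ q b t)))

          c≡ : c ≡ z ++ (q₁ ∷ʳ b)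
          c≡ = ++-assoc z q₁ [ b ]

          c∈T : c ∈ T
          c∈T = factors (++-factor [] t) (subst T v≡ct v∈T)

          q∈T : q ∈ T
          q∈T = ∷ʳ-factor q b c∈T

          reverse-v≡q : reverse v ≡ q ++ b′ ∷ t′
          reverse-v≡q = trans reverse-v≡ (sym (++-assoc z q₁ (b′ ∷ t′)))

          c-not-palindrome : ¬ IsPalindrome c
          c-not-palindrome pal = longer-prefix (λ eq → contradiction (++-conicalʳ q₁ [ b ] eq) λ ())
            (trans xw≡vβ (trans (cong (_++ β) (trans v≡ct (cong (_++ t) c≡))) (++-assoc (z ++ q₁ ∷ʳ b) t β)))
            (subst IsPalindrome c≡ pal)

          f-c : mirror f c ≡ true
          f-c = cong₂ _xor_ (dec-true (c ≟ʷ c) refl)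
                            (dec-false (reverse c ≟ʷ c) (c-not-palindrome ∘ sym))

          c-once : ∀ γ y δ → (u ∷ʳ b) ++ t ≡ γ ++ y ++ δ → y ≢ c
          c-once γ y δ eq refl = contradiction (++-conicalʳ q₁ (b ∷ δ) q₁bδ≡[]) λ ()
            where
            q₁bδ≡[] : q₁ ++ b ∷ δ ≡ []
            q₁bδ≡[] = first γ (q₁ ++ b ∷ δ) (begin
              α ++ z                   ≡⟨ ∷-injectiveʳ v≡ct ⟩
              (u ∷ʳ b) ++ t            ≡⟨ eq ⟩
              γ ++ c ++ δ              ≡⟨ cong (γ ++_) (∷ʳ-++ q b δ) ⟩
              γ ++ q ++ b ∷ δ          ≡⟨ cong (γ ++_) (++-assoc z q₁ (b ∷ δ)) ⟩
              γ ++ z ++ q₁ ++ b ∷ δ    ∎)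

          reverse-c-absent : ∀ γ y δ → (u ∷ʳ b) ++ t ≡ γ ++ y ++ δ → reverse y ≢ c
          reverse-c-absent γ y δ eq ry≡c = b≢b′ (∷-injectiveˡ (++-cancelˡ q _ _ (begin
              q ++ b ∷ reverse (x ∷ γ)      ≡⟨ ∷ʳ-++ q b (reverse (x ∷ γ)) ⟨
              c ++ reverse (x ∷ γ)          ≡⟨ cong (_++ reverse (x ∷ γ)) ry≡c ⟨
              reverse y ++ reverse (x ∷ γ)  ≡⟨ reverse-++ (x ∷ γ) y ⟨
              reverse (x ∷ γ ++ y)          ≡⟨ cong (λ ζ → reverse (x ∷ γ ++ ζ)) (++-identityʳ y) ⟨
              reverse (x ∷ γ ++ y ++ [])    ≡⟨ cong (λ ζ → reverse (x ∷ γ ++ y ++ ζ)) δ≡[] ⟨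
              reverse (x ∷ γ ++ y ++ δ)     ≡⟨ cong (reverse ∘ (x ∷_)) eq ⟨
              reverse (c ++ t)              ≡⟨ cong reverse v≡ct ⟨
              reverse v                     ≡⟨ reverse-v≡q ⟩
              q ++ b′ ∷ t′                  ∎)))
            where
            y≡ : y ≡ reverse (q₁ ∷ʳ b) ++ z
            y≡ = begin
              y                                ≡⟨ reverse-involutive y ⟨
              reverse (reverse y)              ≡⟨ cong reverse (trans ry≡c c≡) ⟩
              reverse (z ++ (q₁ ∷ʳ b))         ≡⟨ reverse-++ z (q₁ ∷ʳ b) ⟩
              reverse (q₁ ∷ʳ b) ++ reverse z   ≡⟨ cong (reverse (q₁ ∷ʳ b) ++_) z-palindrome ⟨
              reverse (q₁ ∷ʳ b) ++ z           ∎

            δ≡[] : δ ≡ []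
            δ≡[] = first (γ ++ reverse (q₁ ∷ʳ b)) δ (begin
              α ++ z                                  ≡⟨ ∷-injectiveʳ v≡ct ⟩
              (u ∷ʳ b) ++ t                           ≡⟨ eq ⟩
              γ ++ y ++ δ                             ≡⟨ cong (λ ζ → γ ++ ζ ++ δ) y≡ ⟩
              γ ++ (reverse (q₁ ∷ʳ b) ++ z) ++ δ      ≡⟨ cong (γ ++_) (++-assoc (reverse (q₁ ∷ʳ b)) z δ) ⟩
              γ ++ reverse (q₁ ∷ʳ b) ++ z ++ δ        ≡⟨ ++-assoc γ (reverse (q₁ ∷ʳ b)) (z ++ δ) ⟨
              (γ ++ reverse (q₁ ∷ʳ b)) ++ z ++ δ      ∎)

          f-vanishes : ∀ γ y δ → (u ∷ʳ b) ++ t ≡ γ ++ y ++ δ → length y ≡ suc (suc (length u)) →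
                       mirror f y ≡ false
          f-vanishes γ y δ eq _ =
            cong₂ _xor_ (dec-false (y ≟ʷ c) (c-once γ y δ eq))
                        (dec-false (reverse y ≟ʷ c) (reverse-c-absent γ y δ eq))

          tail-ends : ∃[ r ] (u ∷ʳ b) ++ t ≡ r ++ reverse q
          tail-ends with reverse (b′ ∷ t′) in eq
          ... | [] = contradiction (trans (sym (length-reverse (b′ ∷ t′))) (cong length eq)) λ ()
          ... | d ∷ r = r , ∷-injectiveʳ (begin
            c ++ t                            ≡⟨ v≡ct ⟨
            v                                 ≡⟨ reverse-involutive v ⟨
            reverse (reverse v)               ≡⟨ cong reverse reverse-v≡q ⟩
            reverse (q ++ b′ ∷ t′)            ≡⟨ reverse-++ q (b′ ∷ t′) ⟩
            reverse (b′ ∷ t′) ++ reverse q    ≡⟨ cong (_++ reverse q) eq ⟩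
            d ∷ r ++ reverse q                ∎)

          absurd : ⊥
          absurd = mirror-coboundary (length u) f λ (g , cob@(g-reverse , g-edge)) →
            let r , ends = tail-ends
                g-constant : g (u ∷ʳ b) ≡ g (reverse q)
                g-constant = potential-constant {f = f} cob t r (length-∷ʳ u b) (length-reverse q) ends
                  (∷-factor x ((u ∷ʳ b) ++ t) (subst T v≡ct v∈T)) f-vanishes
            in contradiction (begin
              true                        ≡⟨ f-c ⟨
              mirror f c                  ≡⟨ g-edge x u b refl c∈T ⟩
              g q xor g (u ∷ʳ b)          ≡⟨ cong (g q xor_) (trans g-constant (g-reverse q refl q∈T)) ⟩
              g q xor g q                 ≡⟨ xor-same (g q) ⟩
              false                       ∎) λ ()

        same-length : ∀ {s₁} → v ≡ z ++ s₁ → length s₁ ≡ length (reverse (x ∷ α))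
        same-length {s₁} v≡zs₁ = ℕ.+-cancelˡ-≡ (length z) _ _ (begin
          length z + length s₁                  ≡⟨ length-++ z ⟨
          length (z ++ s₁)                      ≡⟨ cong length v≡zs₁ ⟨
          length v                              ≡⟨ length-reverse v ⟨
          length (reverse v)                    ≡⟨ cong length reverse-v ⟩
          length (z ++ reverse (x ∷ α))         ≡⟨ length-++ z ⟩
          length z + length (reverse (x ∷ α))   ∎)

        different : ∀ {s₁} → v ≡ z ++ s₁ → s₁ ≢ reverse (x ∷ α)
        different {s₁} v≡zs₁ s₁≡ = longer-prefix {s₁} {β} s₁≢[]
          (trans xw≡vβ (cong (_++ β) v≡zs₁))
          (subst IsPalindrome v≡zs₁ (trans v≡zs₁ (trans (cong (z ++_) s₁≡) (sym reverse-v))))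
          where
          s₁≢[] : s₁ ≢ []
          s₁≢[] eq = contradiction
            (trans (sym (cong length eq)) (trans (same-length v≡zs₁) (length-reverse (x ∷ α)))) λ ()

        absurd : ⊥
        absurd
          with s₁ , v≡zs₁ ← shorter-prefix z v (trans (sym xw≡) xw≡vβ) (length-++-≤ʳ z {x ∷ α})
          with first-difference _≟_ s₁ (reverse (x ∷ α)) (same-length v≡zs₁) (different v≡zs₁)
        ... | q₁ , b , b′ , t , t′ , b≢b′ , refl , s₂≡ =
              Divergence.absurd {q₁} b≢b′ v≡zs₁ (trans reverse-v (cong (z ++_) s₂≡))

      not-factor : ¬ IsFactor z w
      not-factor i with α , β , w≡ , first ← first-occurrence _≟_ z w i = FirstReturn.absurd w≡ first

    empty-full : IsFullWord {A = A} []
    empty-full = [] ∷ [] , [] ∷ [] , (λ u → mk⇔ (λ { (here refl) → refl , factor-refl })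
                                                λ { (_ , here Prefix.[]) → here refl }) , refl

    cons-full : ∀ {x w} → x ∷ w ∈ T → IsFullWord w → IsFullWord (x ∷ w)
    cons-full {x} {w} xw∈T full-w with longest-prefix (λ u → u ≟ʷ reverse u) (x ∷ w)
    ... | inj₂ none = contradiction refl (none [ x ] w refl)
    ... | inj₁ ([] , _ , _ , _ , longest) = contradiction (longest [ x ] w refl refl) λ ()
    ... | inj₁ (z@(_ ∷ z₀) , s , refl , z-palindrome , longest) with full-w
    ... | us , us-unique , us⇔ , |us| =
        z ∷ us , All.tabulate z∉us ∷ us-unique , (λ u → mk⇔ to′ from′) , cong suc |us|
      where
      z-new : ¬ IsFactor z w
      z-new = LongestPalindromicPrefix.not-factor xw∈T refl z-palindrome longest

      z∉us : ∀ {u} → u ∈ˡ us → z ≢ u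
      z∉us u∈us refl = z-new (proj₂ (Equivalence.to (us⇔ z) u∈us))

      to′ : ∀ {u} → u ∈ˡ z ∷ us → IsPalindrome u × IsFactor u (x ∷ w)
      to′ (here refl)  = z-palindrome , ++-factor [] s
      to′ (there u∈us) with pal , i ← Equivalence.to (us⇔ _) u∈us = pal , there i

      -- A shorter palindromic prefix is also a suffix of z, hence a factor of w.
      prefix∈ : ∀ {u t} → IsPalindrome u → x ∷ w ≡ u ++ t → u ∈ˡ z ∷ us
      prefix∈ {u} {t} pal xw≡ with shorter-prefix u z (sym xw≡) (longest u t xw≡ pal)
      ... | r , z≡ur = locate (reverse r) (begin
          z                        ≡⟨ z-palindrome ⟩
          reverse z                ≡⟨ cong reverse z≡ur ⟩
          reverse (u ++ r)         ≡⟨ reverse-++ u r ⟩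
          reverse r ++ reverse u   ≡⟨ cong (reverse r ++_) pal ⟨
          reverse r ++ u           ∎)
        where
        locate : ∀ v → z ≡ v ++ u → u ∈ˡ z ∷ us
        locate []      z≡u  = here (sym z≡u)
        locate (_ ∷ v) z≡vu = there (Equivalence.from (us⇔ u) (pal ,
          subst (IsFactor u) (sym (trans (cong (_++ s) (∷-injectiveʳ z≡vu)) (++-assoc v u s)))
                (++-factor v s)))

      from′ : ∀ {u} → IsPalindrome u × IsFactor u (x ∷ w) → u ∈ˡ z ∷ us
      from′ (pal , there i) = there (Equivalence.from (us⇔ _) (pal , i))
      from′ (pal , here pre) = prefix∈ pal (proj₂ (prefix⇒++ pre))

    treeSet-full : IsFullSet T
    treeSet-full []      _    = empty-full
    treeSet-full (x ∷ w) xw∈T = cons-full xw∈T (treeSet-full w (∷-factor x w xw∈T))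

proposition4p24 : ∀ {a ℓ : Level} {A : Set a} {n : ℕ} → A ↔ Fin n →
    (T : Pred (List A) ℓ) →
    Recurrent T → IsTreeSet T → ClosedUnderReversal T →
    IsFullSet T
proposition4p24 finite T _ = FiniteAlphabet.ReversalClosedTreeSet.treeSet-full finite T
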